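{- Let $n \ge 3$ and let $\boldsymbol{a} = (a_1, a_2, \ldots, a_n)^T$ be a vector of positive integers with $a_1 \le a_2 \le \cdots \le a_n$ whose entries are pairwise coprime, i.e. $\gcd(a_i,a_j)=1$ for all $i,j \in \{1,\ldots,n\}$ with $i \neq j$. Then $$F(\boldsymbol{a}) \le \frac{1}{2}\left(\sqrt{a_1a_2a_3(a_1+a_2+a_3)}-a_1-a_2-a_3\right).$$
   Context: For a vector $\boldsymbol{a}=(a_1,\ldots,a_n)^T$ of positive integers with $n\ge 2$ and $\gcd(a_1,\ldots,a_n)=1$, the Frobenius number is $F(\boldsymbol{a}) := \max\{ b \in \mathbb{Z} : b \ne \sum_{i=1}^n a_i z_i \text{ for all } (z_1,\ldots,z_n) \in \mathbb{Z}_{\ge 0}^n \}$, the largest integer (possibly negative) that is not a nonnegative integer combination of the $a_i$. In particular $F(\boldsymbol{a})=-1$ when some $a_i=1$. -}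

module Defs where

open import Data.Integer.Base as ℤ using (ℤ; +_)
open import Data.Nat.Base as ℕ using (ℕ)
open import Data.Nat.Properties using (+-*-semiring)
open import Data.Product.Base using (Σ-syntax; ∃-syntax; _×_; _,_)
open import Data.Rational.Base
open import Data.Rational.Properties
open import Data.Rational.Solver using (module +-*-Solver)
open import Data.Sum.Base using (_⊎_; inj₁; inj₂)
open import Data.Vec.Functional using (Vector)
open import Relation.Binary.PropositionalEquality
open import Relation.Nullary using (¬_; yes; no)

open import Algebra.Properties.Semiring.Sum +-*-semiring using (sum)

IsRepresentable : ∀ {n} → Vector ℕ n → ℤ → Set
IsRepresentable {n} a b = Σ[ z ∈ Vector ℕ n ] b ≡ + sum (λ i → a i ℕ.* z i)

IsFrobeniusNumber : ∀ {n} → Vector ℕ n → ℤ → Set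
IsFrobeniusNumber a F =
  ¬ IsRepresentable a F × (∀ b → ¬ IsRepresentable a b → b ℤ.≤ F)

-- Real numbers as two-sided Dedekind cuts: L q means q < x, U q means x < q.

record ℝ : Set₁ where
  field
    L U         : ℚ → Set
    L-inhabited : ∃[ q ] L q
    U-inhabited : ∃[ q ] U q
    L-lower     : ∀ {p q} → p < q → L q → L p
    U-upper     : ∀ {p q} → p < q → U p → U q
    L-open      : ∀ {q} → L q → ∃[ r ] q < r × L r
    U-open      : ∀ {q} → U q → ∃[ r ] r < q × U r
    disjoint    : ∀ {q} → L q → ¬ U q
    located     : ∀ {p q} → p < q → L p ⊎ U q

open ℝ

-- The lower cut determines the upper one, so inclusion of lower cuts suffices.
infix 4 _≤ᵣ_
_≤ᵣ_ : ℝ → ℝ → Set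
x ≤ᵣ y = ∀ {q} → L x q → L y q

private
  p-1<p : ∀ p → p - 1ℚ < p
  p-1<p p = subst (p - 1ℚ <_) (+-identityʳ p) (+-monoʳ-< p (negative⁻¹ (- 1ℚ)))

  p<p+1 : ∀ p → p < p + 1ℚ
  p<p+1 p = subst (_< p + 1ℚ) (+-identityʳ p) (+-monoʳ-< p (positive⁻¹ 1ℚ))

fromℚ : ℚ → ℝ
fromℚ x = record
  { L = _< x
  ; U = x <_
  ; L-inhabited = x - 1ℚ , p-1<p x
  ; U-inhabited = x + 1ℚ , p<p+1 x
  ; L-lower = <-trans
  ; U-upper = λ p<q x<p → <-trans x<p p<q
  ; L-open = <-dense
  ; U-open = λ x<q → let r , x<r , r<q = <-dense x<q in r , r<q , x<r
  ; disjoint = <-asym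
  ; located = loc
  }
  where
  loc : ∀ {p q} → p < q → p < x ⊎ x < q
  loc {p} p<q with p <? x
  ... | yes p<x = inj₁ p<x
  ... | no  p≮x = inj₂ (≤-<-trans (≮⇒≥ p≮x) p<q)

fromℤ : ℤ → ℝ
fromℤ b = fromℚ (b / 1)

-- q < x - c iff q + c < x.
infixl 6 _-ᵣ_
_-ᵣ_ : ℝ → ℕ → ℝ
x -ᵣ n = record
  { L = λ q → L x (q + c)
  ; U = λ q → U x (q + c)
  ; L-inhabited = let q , l = L-inhabited x in q - c , subst (L x) (sym (cancel q)) l
  ; U-inhabited = let q , u = U-inhabited x in q - c , subst (U x) (sym (cancel q)) u
  ; L-lower = λ p<q → L-lower x (+-monoˡ-< c p<q)
  ; U-upper = λ p<q → U-upper x (+-monoˡ-< c p<q)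
  ; L-open = λ {q} l → let r , q+c<r , l′ = L-open x l in
      r - c
    , subst (_< r - c) (cancel′ q) (+-monoˡ-< (- c) q+c<r)
    , subst (L x) (sym (cancel r)) l′
  ; U-open = λ {q} u → let r , r<q+c , u′ = U-open x u in
      r - c
    , subst (r - c <_) (cancel′ q) (+-monoˡ-< (- c) r<q+c)
    , subst (U x) (sym (cancel r)) u′
  ; disjoint = disjoint x
  ; located = λ p<q → located x (+-monoˡ-< c p<q)
  }
  where
  open +-*-Solver
  c : ℚ
  c = + n / 1
  cancel : ∀ q → q - c + c ≡ q
  cancel q = solve 2 (λ q c → q :- c :+ c := q) refl q c
  cancel′ : ∀ q → q + c - c ≡ q
  cancel′ q = solve 2 (λ q c → q :+ c :- c := q) refl q c

-- q < ½ x iff q + q < x.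
infix 8 ½·_
½·_ : ℝ → ℝ
½· x = record
  { L = λ q → L x (q + q)
  ; U = λ q → U x (q + q)
  ; L-inhabited = let q , l = L-inhabited x in ½ * q , subst (L x) (sym (double q)) l
  ; U-inhabited = let q , u = U-inhabited x in ½ * q , subst (U x) (sym (double q)) u
  ; L-lower = λ p<q → L-lower x (+-mono-< p<q p<q)
  ; U-upper = λ p<q → U-upper x (+-mono-< p<q p<q)
  ; L-open = λ {q} l → let r , 2q<r , l′ = L-open x l in
      ½ * r
    , subst (_< ½ * r) (half q) (*-monoʳ-<-pos ½ 2q<r)
    , subst (L x) (sym (double r)) l′
  ; U-open = λ {q} u → let r , r<2q , u′ = U-open x u in
      ½ * r
    , subst (½ * r <_) (half q) (*-monoʳ-<-pos ½ r<2q)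
    , subst (U x) (sym (double r)) u′
  ; disjoint = disjoint x
  ; located = λ p<q → located x (+-mono-< p<q p<q)
  }
  where
  double : ∀ q → ½ * q + ½ * q ≡ q
  double q = trans (sym (*-distribʳ-+ q ½ ½)) (*-identityˡ q)
  half : ∀ q → ½ * (q + q) ≡ q
  half q = trans (*-distribˡ-+ ½ q q) (double q)

private
  0≤n/1 : ∀ n → 0ℚ ≤ + n / 1
  0≤n/1 n = nonNegative⁻¹ (+ n / 1) {{normalize-nonNeg n 1}}

  p<q⇒0<q-p : ∀ {p q} → p < q → 0ℚ < q - p
  p<q⇒0<q-p {p} {q} p<q = subst (_< q - p) (+-inverseʳ p) (+-monoˡ-< (- p) p<q)

  0<q-p⇒p<q : ∀ {p q} → 0ℚ < q - p → p < q
  0<q-p⇒p<q {p} {q} 0<q-p =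
    subst₂ _<_ (+-identityˡ p)
      (solve 2 (λ p q → q :- p :+ p := q) refl p q) (+-monoˡ-< p 0<q-p)
    where open +-*-Solver

  0<p*q : ∀ {p q} → 0ℚ < p → 0ℚ < q → 0ℚ < p * q
  0<p*q {p} {q} 0<p 0<q =
    positive⁻¹ (p * q) {{pos*pos⇒pos p {{positive 0<p}} q {{positive 0<q}}}}

  sq-mono : ∀ {p q} → 0ℚ ≤ p → p < q → p * p < q * q
  sq-mono {p} {q} 0≤p p<q = ≤-<-trans
    (*-monoˡ-≤-nonNeg p {{nonNegative 0≤p}} (<⇒≤ p<q))
    (*-monoˡ-<-pos q {{positive (≤-<-trans 0≤p p<q)}} p<q)

  -- For q ≥ 0, r = (q k + c) / (q + k) with k = c + 1 lies strictly between
  -- q and √c, since r² - c = (k² - c) (q² - c) / (q + k)².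
  module Approx (c : ℚ) (0≤c : 0ℚ ≤ c) (q : ℚ) (0≤q : 0ℚ ≤ q) where
    open +-*-Solver

    k t : ℚ
    k = c + 1ℚ
    t = q + k

    0<k : 0ℚ < k
    0<k = ≤-<-trans 0≤c (p<p+1 c)

    0<t : 0ℚ < t
    0<t = +-mono-≤-< 0≤q 0<k

    instance
      t-pos : Positive t
      t-pos = positive 0<t
      t-nonNeg : NonNegative t
      t-nonNeg = pos⇒nonNeg t
      t-nonZero : NonZero t
      t-nonZero = pos⇒nonZero t

    r : ℚ
    r = (q * k + c) * 1/ t

    rt : r * t ≡ q * k + c
    rt = begin
      (q * k + c) * 1/ t * t   ≡⟨ *-assoc (q * k + c) (1/ t) t ⟩
      (q * k + c) * (1/ t * t) ≡⟨ cong ((q * k + c) *_) (*-inverseˡ t) ⟩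
      (q * k + c) * 1ℚ         ≡⟨ *-identityʳ (q * k + c) ⟩
      q * k + c                ∎
      where open ≡-Reasoning

    qt : q * t ≡ q * k + q * q
    qt = solve 2 (λ q k → q :* (q :+ k) := q :* k :+ q :* q) refl q k

    rrtt : r * r * t * t ≡ (q * k + c) * (q * k + c)
    rrtt = trans
      (solve 2 (λ r t → r :* r :* t :* t := (r :* t) :* (r :* t)) refl r t)
      (cong₂ _*_ rt rt)

    0<k²-c : 0ℚ < k * k - c
    0<k²-c = p<q⇒0<q-p (<-≤-trans (p<p+1 c)
      (subst (_≤ k * k) (*-identityˡ k)
        (*-monoʳ-≤-nonNeg k {{nonNegative (<⇒≤ 0<k)}} 1≤k)))
      where
      1≤k : 1ℚ ≤ k
      1≤k = subst (_≤ k) (+-identityˡ 1ℚ) (+-monoˡ-≤ 1ℚ 0≤c)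

    cancel-t² : ∀ {x y} → x * t * t < y * t * t → x < y
    cancel-t² lt = *-cancelʳ-<-nonNeg t (*-cancelʳ-<-nonNeg t lt)

    q<r : q * q < c → q < r
    q<r q²<c = *-cancelʳ-<-nonNeg t
      (subst₂ _<_ (sym qt) (sym rt) (+-monoʳ-< (q * k) q²<c))

    r<q : c < q * q → r < q
    r<q c<q² = *-cancelʳ-<-nonNeg t
      (subst₂ _<_ (sym rt) (sym qt) (+-monoʳ-< (q * k) c<q²))

    r²<c : q * q < c → r * r < c
    r²<c q²<c = cancel-t² (subst (_< c * t * t) (sym rrtt) (0<q-p⇒p<q
      (subst (0ℚ <_)
        (solve 3 (λ c q k →
            (k :* k :- c) :* (c :- q :* q)
              := c :* (q :+ k) :* (q :+ k) :- (q :* k :+ c) :* (q :* k :+ c))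
          refl c q k)
        (0<p*q 0<k²-c (p<q⇒0<q-p q²<c)))))

    c<r² : c < q * q → c < r * r
    c<r² c<q² = cancel-t² (subst (c * t * t <_) (sym rrtt) (0<q-p⇒p<q
      (subst (0ℚ <_)
        (solve 3 (λ c q k →
            (k :* k :- c) :* (q :* q :- c)
              := (q :* k :+ c) :* (q :* k :+ c) :- c :* (q :+ k) :* (q :+ k))
          refl c q k)
        (0<p*q 0<k²-c (p<q⇒0<q-p c<q²)))))

    0<r : 0ℚ < q → 0ℚ < r
    0<r 0<q = *-cancelʳ-<-nonNeg t (subst₂ _<_ (sym (*-zeroˡ t)) (sym rt)
      (+-mono-<-≤ (0<p*q 0<q 0<k) 0≤c))

infix 8 √_
√_ : ℕ → ℝ
√ n = record
  { L = Lower
  ; U = Upper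
  ; L-inhabited = - 1ℚ , inj₁ (negative⁻¹ (- 1ℚ))
  ; U-inhabited = k , 0<k , 0<q-p⇒p<q 0<k²-c
  ; L-lower = lower
  ; U-upper = λ p<q (0<p , c<p²) → <-trans 0<p p<q , <-trans c<p² (sq-mono (<⇒≤ 0<p) p<q)
  ; L-open = lopen
  ; U-open = λ {q} (0<q , c<q²) →
      let open Approx c 0≤c q (<⇒≤ 0<q) using (r; r<q; 0<r; c<r²)
      in r , r<q c<q² , 0<r 0<q , c<r² c<q²
  ; disjoint = disj
  ; located = loc
  }
  where
  c : ℚ
  c = + n / 1

  0≤c : 0ℚ ≤ c
  0≤c = 0≤n/1 n

  open Approx c 0≤c 0ℚ ≤-refl using (k; 0<k; 0<k²-c)

  Lower Upper : ℚ → Set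
  Lower q = q < 0ℚ ⊎ q * q < c
  Upper q = 0ℚ < q × c < q * q

  lower : ∀ {p q} → p < q → Lower q → Lower p
  lower p<q (inj₁ q<0) = inj₁ (<-trans p<q q<0)
  lower {p} p<q (inj₂ q²<c) with p <? 0ℚ
  ... | yes p<0 = inj₁ p<0
  ... | no  p≮0 = inj₂ (<-trans (sq-mono (≮⇒≥ p≮0) p<q) q²<c)

  lopen : ∀ {q} → Lower q → ∃[ r ] q < r × Lower r
  lopen (inj₁ q<0) = let r , q<r , r<0 = <-dense q<0 in r , q<r , inj₁ r<0
  lopen {q} (inj₂ q²<c) with q <? 0ℚ
  ... | yes q<0 = lopen (inj₁ q<0)
  ... | no  q≮0 = A.r , A.q<r q²<c , inj₂ (A.r²<c q²<c)
    where module A = Approx c 0≤c q (≮⇒≥ q≮0)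

  disj : ∀ {q} → Lower q → ¬ Upper q
  disj (inj₁ q<0)  (0<q , _)  = <-asym q<0 0<q
  disj (inj₂ q²<c) (_ , c<q²) = <-asym q²<c c<q²

  loc : ∀ {p q} → p < q → Lower p ⊎ Upper q
  loc {p} p<q with p <? 0ℚ | p * p <? c
  ... | yes p<0 | _        = inj₁ (inj₁ p<0)
  ... | no  _   | yes p²<c = inj₁ (inj₂ p²<c)
  ... | no  p≮0 | no  p²≮c =
    inj₂ (≤-<-trans (≮⇒≥ p≮0) p<q , ≤-<-trans (≮⇒≥ p²≮c) (sq-mono (≮⇒≥ p≮0) p<q))

{-# OPTIONS --safe #-}

-- Only the three smallest entries a, b, c matter; put s = a + b + c. The
-- bound F ≤ a b - a - b already suffices when c ≥ a + b or c s ≥ 4 a b.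
-- Otherwise a, b and c are within a factor 3/2 of each other. There are
-- r, u ≥ 1 with r b + u a = a b + c, and up to exchanging a and b we have
-- 2 r ≤ a + 1; moreover r ≠ 1 since b < c < a + b. Because r b ≡ c modulo a,
-- every residue modulo a is hit by some x b + y c with x < r and y ≤ k, where
-- k = ⌊(a - 1) / r⌋, so F ≤ (r - 1) b + k c - a. From r, k and c s < 4 a b one
-- gets 12 (2 F + s) ≤ 12 a b + 6 a c + 10 c, whose square is at most 144 a b c s.
module Submission where

open import Defs
open import Data.Fin.Base as Fin using (Fin)
open import Data.Fin.Patterns using (0F; 1F; 2F)
open import Data.Integer.Base using (ℤ)
open import Data.Nat.Base as ℕ using (ℕ; zero; suc; z≤n; s≤s)
open import Data.Nat.Coprimality as Coprime using (Coprime; gcd≡1⇒coprime)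
import Data.Nat.Divisibility as ℕ
import Data.Nat.DivMod as ℕ
open import Data.Nat.GCD using (gcd)
import Data.Nat.Properties as ℕ
open import Data.Product.Base using (∃-syntax; _×_; _,_)
open import Data.Vec.Functional using (Vector)
open import Relation.Binary.PropositionalEquality
open import Relation.Nullary using (Dec; ¬_; yes; no; contradiction)

-- The bound over the integers, in squared form.

module Integers where

  open import Data.Integer.Base hiding (suc)
  open import Data.Integer.DivMod using (_%ℕ_; _/ℕ_; n%ℕd<d; a≡a%ℕn+[a/ℕn]*n)
  open import Data.Integer.Properties
  open import Data.Integer.Tactic.RingSolver using (solve-∀; solve)
  open import Data.List.Base using ([]; _∷_)
  open import Data.Nat.Coprimality using (coprime-Bézout)
  open import Data.Nat.GCD using (module Bézout)

  -- Polynomial inequalities are certified by writing the difference of the two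
  -- sides as a sum of products of quantities known to be nonnegative.
  infixl 6 _⊞_
  infixl 7 _⊠_

  _⊞_ : ∀ {i j} → 0ℤ ≤ i → 0ℤ ≤ j → 0ℤ ≤ i + j
  _⊞_ = +-mono-≤

  _⊠_ : ∀ {i j} → 0ℤ ≤ i → 0ℤ ≤ j → 0ℤ ≤ i * j
  _⊠_ {+ m} {+ n} _ _ = subst (0ℤ ≤_) (pos-* m n) (+≤+ z≤n)

  0≤+ : ∀ n → 0ℤ ≤ + n
  0≤+ n = +≤+ z≤n

  gap : ∀ {i j} → i ≤ j → 0ℤ ≤ j - i
  gap = i≤j⇒0≤j-i

  gap< : ∀ {i j} → i < j → 0ℤ ≤ j - (+ 1 + i)
  gap< i<j = gap (i<j⇒suc[i]≤j i<j)

  ≤-by : ∀ {i j e} → 0ℤ ≤ e → j - i ≡ e → i ≤ j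
  ≤-by 0≤e eq = 0≤i-j⇒j≤i (subst (0ℤ ≤_) (sym eq) 0≤e)

  -- Contradictory inequalities are refuted by combining them into a nonnegative `e` that a ring
  -- identity forces to be `-1`.
  nonneg+1≢0 : ∀ {e} → 0ℤ ≤ e → e + + 1 ≢ 0ℤ
  nonneg+1≢0 {+ n} _ eq with () ← trans (+-comm (+ 1) (+ n)) eq

  ≤-by-contradiction : ∀ {i j} → ¬ (0ℤ ≤ i - (+ 1 + j)) → i ≤ j
  ≤-by-contradiction {i} {j} i≯j with i ≤? j
  ... | yes i≤j = i≤j
  ... | no  i≰j = contradiction (gap< (≰⇒> i≰j)) i≯j

  square-≤ : ∀ {x y n} → x ≤ y → y * y ≤ n → 0ℤ ≤ x → x * x ≤ n
  square-≤ {x} {y} x≤y y²≤n 0≤x = ≤-trans x²≤y² y²≤n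
    where
    x²≤y² : x * x ≤ y * y
    x²≤y² = ≤-by (gap x≤y ⊠ (gap x≤y ⊞ 0≤+ 2 ⊠ 0≤x)) (solve (x ∷ y ∷ []))

  -- Polynomial inequalities between the three smallest entries.

  module Inequalities {a b c : ℤ} (0<a : 0ℤ < a) (0<b : 0ℤ < b) where

    private
      0≤a : 0ℤ ≤ a
      0≤a = <⇒≤ 0<a

      0≤b : 0ℤ ≤ b
      0≤b = <⇒≤ 0<b

    -- The squared quantity is `2 (a b - a - b) + s`. The certificate is the Taylor expansion of the
    -- difference at `c = a + b`, in powers of `t`; writing `a = p + 1` and `b = q + 1` shows that
    -- its coefficients are nonnegative.
    sylvester²≤-if-a+b≤c : a + b ≤ c →
      (+ 2 * a * b - a - b + c) * (+ 2 * a * b - a - b + c) ≤ a * b * c * (a + b + c)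
    sylvester²≤-if-a+b≤c a+b≤c = ≤-by
      (0≤+ 2 ⊠ 0≤a ⊠ 0≤b ⊠ (0≤a ⊠ 0≤a ⊞ 0≤b ⊠ 0≤b)
        ⊞ 0≤a ⊠ 0≤b ⊠ t ⊠ (0≤+ 3 ⊠ p ⊞ 0≤+ 3 ⊠ q ⊞ 0≤+ 2)
        ⊞ t ⊠ t ⊠ (p ⊠ q ⊞ p ⊞ q))
      (solve (a ∷ b ∷ c ∷ []))
      where
      t = gap a+b≤c
      p = gap< 0<a
      q = gap< 0<b

    -- With `d = a + b - c` the square is `4 a^2 b^2 - d (4 a b - d)`, where `0 ≤ d ≤ 4 a b`, and
    -- `4 a^2 b^2 ≤ a b c s`.
    sylvester²≤-if-4ab≤cs : 0ℤ ≤ c → c ≤ a + b → + 4 * a * b ≤ c * (a + b + c) →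
      (+ 2 * a * b - a - b + c) * (+ 2 * a * b - a - b + c) ≤ a * b * c * (a + b + c)
    sylvester²≤-if-4ab≤cs 0≤c c≤a+b 4ab≤cs = ≤-by
      (0≤a ⊠ 0≤b ⊠ gap 4ab≤cs
        ⊞ gap c≤a+b ⊠ (0≤+ 2 ⊠ 0≤a ⊠ 0≤b ⊞ 0≤a ⊠ gap< 0<b ⊞ 0≤b ⊠ gap< 0<a ⊞ 0≤c))
      (solve (a ∷ b ∷ c ∷ []))

    module _ (a≤c : a ≤ c) (cs<4ab : c * (a + b + c) < + 4 * a * b) where

      private
        0≤c : 0ℤ ≤ c
        0≤c = ≤-trans 0≤a a≤c

      -- If `3 b < 2 a`, then `c ≥ a` gives `c s ≥ a (2 a + b) > 4 a b`.
      2a≤3b : + 2 * a ≤ + 3 * b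
      2a≤3b = ≤-by-contradiction λ 2a>3b → nonneg+1≢0
        (gap< cs<4ab ⊞ 0≤a ⊠ 2a>3b ⊞ 0≤a ⊞ gap a≤c ⊠ (0≤+ 2 ⊠ 0≤a ⊞ 0≤b ⊞ 0≤c))
        (solve (a ∷ b ∷ c ∷ []))

      -- If `3 b < 2 c`, then `3 b s < 2 c s < 8 a b`, so `3 (b + c) < 5 a`; with `a ≤ c` this
      -- contradicts `2a≤3b`.
      2c≤3b : + 2 * c ≤ + 3 * b
      2c≤3b = ≤-by-contradiction λ 2c>3b → nonneg+1≢0
        (0≤+ 2 ⊠ gap< cs<4ab
          ⊞ 2c>3b ⊠ (0≤a ⊞ 0≤b ⊞ 0≤c) ⊞ (0≤a ⊞ 0≤b ⊞ 0≤c)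
          ⊞ 0≤b ⊠ gap 2a≤3b ⊞ 0≤+ 3 ⊠ 0≤b ⊠ gap a≤c ⊞ 0≤+ 1)
        (solve (a ∷ b ∷ c ∷ []))

    module _ (a<c : a < c) (b<c : b < c) (2c≤3a : + 2 * c ≤ + 3 * a) (2c≤3b : + 2 * c ≤ + 3 * b) where

      -- Raising `b` and then `a` to `c - 1` increases `4 a b - c s` by `y (4 a - c)` and
      -- `x (3 c - 4)`, both nonnegative. The final value `c^2 - 6 c + 4` is negative for
      -- `1 ≤ c ≤ 5`.
      6≤c : c * (a + b + c) < + 4 * a * b → + 6 ≤ c
      6≤c cs<4ab = ≤-by-contradiction λ c<6 → nonneg+1≢0
        (gap< cs<4ab
          ⊞ x ⊠ (0≤+ 3 ⊠ x ⊞ 0≤+ 3 ⊠ gap< 0<a ⊞ 0≤+ 2)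
          ⊞ y ⊠ (gap 2c≤3a ⊞ 0≤a ⊞ (x ⊞ 0≤a ⊞ 0≤+ 1))
          ⊞ (x ⊞ 0≤a) ⊠ c<6 ⊞ 0≤+ 1)
        (solve (a ∷ b ∷ c ∷ []))
        where
        x = gap< a<c
        y = gap< b<c

      -- The quartic part of the difference is `144 a b^2 (c - a) + 36 a c^2 (4 b - a)`. By
      -- `2 c ≤ 3 b` and `a < c` its second term is at least `60 a c^3`, which for `c ≥ 6` absorbs
      -- the lower-order terms coming from `10 c`.
      [12ab+6ac+10c]²≤144abcs : + 6 ≤ c →
        (+ 12 * a * b + + 6 * a * c + + 10 * c) * (+ 12 * a * b + + 6 * a * c + + 10 * c)
          ≤ + 144 * (a * b * c * (a + b + c))
      [12ab+6ac+10c]²≤144abcs 6≤c = ≤-by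
        (0≤+ 2 ⊠
          (0≤+ 72 ⊠ 0≤a ⊠ 0≤b ⊠ 0≤b ⊠ x
            ⊞ 0≤+ 24 ⊠ 0≤a ⊠ 0≤c ⊠ 0≤c ⊠ gap 2c≤3b
            ⊞ 0≤+ 18 ⊠ 0≤a ⊠ 0≤c ⊠ 0≤c ⊠ x
            ⊞ 0≤+ 30 ⊠ 0≤a ⊠ 0≤c ⊠ 0≤c ⊠ gap 6≤c
            ⊞ 0≤+ 45 ⊠ 0≤a ⊠ 0≤c
            ⊞ 0≤+ 120 ⊠ 0≤a ⊠ 0≤c ⊠ gap< b<c
            ⊞ 0≤+ 25 ⊠ 0≤c ⊠ gap 2c≤3a))
        (solve (a ∷ b ∷ c ∷ []))
        where
        x = gap (<⇒≤ a<c)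
        0≤c = ≤-trans 0≤a (<⇒≤ a<c)

  -- Representability by three generators, and residues modulo the first.

  infix 4 _∈⟨_,_,_⟩
  _∈⟨_,_,_⟩ : ℤ → ℕ → ℕ → ℕ → Set
  N ∈⟨ a , b , c ⟩ = ∃[ x ] ∃[ y ] ∃[ z ] N ≡ + a * + x + + b * + y + + c * + z

  ∈-swap : ∀ {N} a b c → N ∈⟨ b , a , c ⟩ → N ∈⟨ a , b , c ⟩
  ∈-swap a b c (x , y , z , eq) =
    y , x , z , trans eq (cong (_+ + c * + z) (+-comm (+ b * + x) (+ a * + y)))

  bézout-ℤ : ∀ {a b} → Coprime a b → ∃[ i ] ∃[ j ] i * + b ≡ + 1 + j * + a
  bézout-ℤ {a} {b} a⊥b with coprime-Bézout a⊥b
  ... | Bézout.+- x y eq = - + y , - + x , negate (+ a) (+ b) (+ x) (+ y) (begin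
      + 1 + + y * + b      ≡⟨ cong (_+_ (+ 1)) (pos-* y b) ⟨
      + (1 ℕ.+ y ℕ.* b)    ≡⟨ cong +_ eq ⟩
      + (x ℕ.* a)          ≡⟨ pos-* x a ⟩
      + x * + a            ∎)
    where
    open ≡-Reasoning
    negate : ∀ a b x y → + 1 + y * b ≡ x * a → - y * b ≡ + 1 + - x * a
    negate a b x y eq = begin
      - y * b              ≡⟨ l₁ b y ⟩
      + 1 - (+ 1 + y * b)  ≡⟨ cong (_-_ (+ 1)) eq ⟩
      + 1 - x * a          ≡⟨ l₂ a x ⟩
      + 1 + - x * a        ∎
      where
      l₁ : ∀ b y → - y * b ≡ + 1 - (+ 1 + y * b)
      l₁ = solve-∀
      l₂ : ∀ a x → + 1 - x * a ≡ + 1 + - x * a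
      l₂ = solve-∀
  ... | Bézout.-+ x y eq = + y , + x , (begin
      + y * + b            ≡⟨ pos-* y b ⟨
      + (y ℕ.* b)          ≡⟨ cong +_ eq ⟨
      + (1 ℕ.+ x ℕ.* a)    ≡⟨ cong (_+_ (+ 1)) (pos-* x a) ⟩
      + 1 + + x * + a      ∎)
    where open ≡-Reasoning

  -- The Bézout coefficient `i` inverts `b` modulo `a`, so `t` is the remainder of `N i`. The
  -- cofactor `w` may be negative.
  residue : ∀ {a b} .{{_ : ℕ.NonZero a}} → Coprime a b → (N : ℤ) →
    ∃[ t ] ∃[ w ] t ℕ.< a × N ≡ + t * + b + w * + a
  residue {a} {b} a⊥b N with bézout-ℤ a⊥b
  ... | i , j , ib≡1+ja = (N * i) %ℕ a , q * + b - N * j , n%ℕd<d (N * i) a , (begin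
      N                                      ≡⟨ l₁ N (+ a) j ⟩
      N * (+ 1 + j * + a) - N * j * + a      ≡⟨ cong (λ k → N * k - N * j * + a) ib≡1+ja ⟨
      N * (i * + b) - N * j * + a            ≡⟨ l₂ N (+ a) (+ b) i j ⟩
      N * i * + b - N * j * + a              ≡⟨ cong (λ k → k * + b - N * j * + a) (a≡a%ℕn+[a/ℕn]*n (N * i) a) ⟩
      (t + q * + a) * + b - N * j * + a      ≡⟨ l₃ t q N (+ a) (+ b) j ⟩
      t * + b + (q * + b - N * j) * + a      ∎)
    where
    open ≡-Reasoning
    q = (N * i) /ℕ a
    t = + ((N * i) %ℕ a)
    l₁ : ∀ N a j → N ≡ N * (+ 1 + j * a) - N * j * a
    l₁ = solve-∀
    l₂ : ∀ N a b i j → N * (i * b) - N * j * a ≡ N * i * b - N * j * a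
    l₂ = solve-∀
    l₃ : ∀ t q N a b j → (t + q * a) * b - N * j * a ≡ t * b + (q * b - N * j) * a
    l₃ = solve-∀

  regroup : ∀ a b c x y r v w → r * b ≡ c + w * a →
    (x + y * r) * b + v * a ≡ a * (y * w + v) + b * x + c * y
  regroup a b c x y r v w eq = begin
    (x + y * r) * b + v * a            ≡⟨ l₁ x y r v a b ⟩
    x * b + y * (r * b) + v * a        ≡⟨ cong (λ z → x * b + y * z + v * a) eq ⟩
    x * b + y * (c + w * a) + v * a    ≡⟨ l₂ x y w v a b c ⟩
    a * (y * w + v) + b * x + c * y    ∎
    where
    open ≡-Reasoning
    l₁ : ∀ x y r v a b → (x + y * r) * b + v * a ≡ x * b + y * (r * b) + v * a
    l₁ = solve-∀
    l₂ : ∀ x y w v a b c → x * b + y * (c + w * a) + v * a ≡ a * (y * w + v) + b * x + c * y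
    l₂ = solve-∀

  -- N is congruent to t b modulo a for some t < a. Divide t = x + y r and trade
  -- y copies of r b for y copies of c: N differs from x b + y c by a multiple of
  -- a, which is negative when N is not representable.
  nonrepresentable-≤ : ∀ {a b c} .{{_ : ℕ.NonZero a}} → Coprime a b →
    ∀ {r k w} .{{_ : ℕ.NonZero r}} → + r * + b ≡ + c + w * + a → a ℕ.≤ suc k ℕ.* r →
    ∀ {N} → ¬ N ∈⟨ a , b , c ⟩ → N ≤ (+ r - + 1) * + b + + k * + c - + a
  nonrepresentable-≤ {a} {b} {c} a⊥b {r} {k} {w} rb≡c+wa a≤[1+k]r {N} N∉ =
    let t , v , t<a , N≡tb+va = residue a⊥b N
        x = t ℕ.% r
        y = t ℕ./ r
        t≡x+yr = trans (cong +_ (ℕ.m≡m%n+[m/n]*n t r)) (cong (_+_ (+ x)) (pos-* y r))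
    in go x y (ℕ.m%n<n t r) (ℕ.s≤s⁻¹ (ℕ.m<n*o⇒m/o<n (ℕ.<-≤-trans t<a a≤[1+k]r))) (+ y * w + v) (begin
      N                                                ≡⟨ N≡tb+va ⟩
      + t * + b + v * + a                              ≡⟨ cong (λ t → t * + b + v * + a) t≡x+yr ⟩
      (+ x + + y * + r) * + b + v * + a                ≡⟨ regroup (+ a) (+ b) (+ c) (+ x) (+ y) (+ r) v w rb≡c+wa ⟩
      + a * (+ y * w + v) + + b * + x + + c * + y      ∎)
    where
    open ≡-Reasoning
    l : ∀ x y r k u a b c → (r - + 1) * b + k * c - a - (a * u + b * x + c * y)
      ≡ (r - (+ 1 + x)) * b + (k - y) * c + (- + 1 - u) * a
    l = solve-∀
    go : ∀ x y → x ℕ.< r → y ℕ.≤ k → ∀ u → N ≡ + a * u + + b * + x + + c * + y →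
      N ≤ (+ r - + 1) * + b + + k * + c - + a
    go x y x<r y≤k (+ u) eq = contradiction (u , x , y , eq) N∉
    go x y x<r y≤k u@(-[1+ m ]) refl = ≤-by
      (gap< (+<+ x<r) ⊠ 0≤+ b ⊞ gap (+≤+ y≤k) ⊠ 0≤+ c ⊞ 0≤+ m ⊠ 0≤+ a)
      (l (+ x) (+ y) (+ r) (+ k) u (+ a) (+ b) (+ c))

  -- The squared bound and the estimates that lead to it.

  shifted : (a b c F : ℤ) → ℤ
  shifted a b c F = + 2 * F + (a + b + c)

  -- This is `2 F + s ≤ √(a b c s)` without the root. A negative left side satisfies it outright, so
  -- squares are compared only when that side is nonnegative.
  Bound : (a b c F : ℤ) → Set
  Bound a b c F = 0ℤ ≤ shifted a b c F →
    shifted a b c F * shifted a b c F ≤ a * b * c * (a + b + c)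

  bound-swap : ∀ a b c F → Bound b a c F → Bound a b c F
  bound-swap a b c F = subst₂ (λ g n → 0ℤ ≤ g → g * g ≤ n)
    (cong (λ x → + 2 * F + (x + c)) (+-comm b a)) (l a b c)
    where
    l : ∀ a b c → b * a * c * (b + a + c) ≡ a * b * c * (a + b + c)
    l = solve-∀

  -- The bound F ≤ a b - a - b for the first two generators.
  sylvester-≤ : ∀ {a b c F} .{{_ : ℕ.NonZero a}} → Coprime a b → ¬ F ∈⟨ a , b , c ⟩ →
    shifted (+ a) (+ b) (+ c) F ≤ + 2 * + a * + b - + a - + b + + c
  sylvester-≤ {a@(suc a-1)} {b} {c} {F} a⊥b F∉ = ≤-by (0≤+ 2 ⊠ gap F≤) (l₃ (+ a-1) (+ b) (+ c) F)
    where
    l₁ : ∀ a b c x y z → a * x + b * y + b * z ≡ a * x + b * (y + z) + c * + 0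
    l₁ = solve-∀
    l₂ : ∀ a b → + 1 * b ≡ b + 0ℤ * a
    l₂ = solve-∀
    l₃ : ∀ a b c F → + 2 * (+ 1 + a) * b - (+ 1 + a) - b + c - (+ 2 * F + ((+ 1 + a) + b + c))
      ≡ + 2 * ((+ 1 - + 1) * b + a * b - (+ 1 + a) - F)
    l₃ = solve-∀
    F∉⟨a,b,b⟩ : ¬ F ∈⟨ a , b , b ⟩
    F∉⟨a,b,b⟩ (x , y , z , eq) =
      F∉ (x , y ℕ.+ z , 0 , trans eq (l₁ (+ a) (+ b) (+ c) (+ x) (+ y) (+ z)))
    F≤ : F ≤ (+ 1 - + 1) * + b + + a-1 * + b - + a
    -- Here `b` doubles as the third generator: `r = 1` trades `b` for itself, and `k = a - 1`.
    F≤ = nonrepresentable-≤ a⊥b {1} {a-1} {0ℤ} (l₂ (+ a) (+ b))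
      (ℕ.≤-reflexive (sym (ℕ.*-identityʳ a))) F∉⟨a,b,b⟩

  -- Entries equal to 1 are coprime without being distinct, so `strict-bound`, which assumes `a < c`
  -- and `b < c`, does not cover this case. The square to be bounded is `(b + c - 1)^2`.
  bound-1 : ∀ {b c F} → 0 ℕ.< b → 0 ℕ.< c → ¬ F ∈⟨ 1 , b , c ⟩ → Bound (+ 1) (+ b) (+ c) F
  bound-1 {b} {c} 0<b 0<c F∉ =
    square-≤ (sylvester-≤ (Coprime.1-coprimeTo b) F∉)
      (≤-by (q ⊠ r ⊠ (0≤+ 1 ⊞ 0≤+ b ⊞ 0≤+ c) ⊞ 0≤+ 2 ⊠ (q ⊞ 0≤+ c)) (l (+ b) (+ c)))
    where
    q = gap< (+<+ 0<b)
    r = gap< (+<+ 0<c)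
    l : ∀ b c → + 1 * b * c * (+ 1 + b + c) - (+ 2 * + 1 * b - + 1 - b + c) * (+ 2 * + 1 * b - + 1 - b + c)
      ≡ (b - + 1) * (c - + 1) * (+ 1 + b + c) + + 2 * ((b - + 1) + c)
    l = solve-∀

  -- Equality would make `c - b = (u - b) a` a multiple of `a` strictly between `0` and `a`. This
  -- excludes `r = 1`.
  b+ua≢ab+c : ∀ {a b c u} → 0ℤ ≤ a → b < c → c < a + b → + 1 * b + u * a ≢ a * b + c
  b+ua≢ab+c {a} {b} {c} {u} 0≤a b<c c<a+b eq with u ≤? b
  ... | yes u≤b = nonneg+1≢0 (gap u≤b ⊠ 0≤a ⊞ gap< b<c) (trans (l₁ a b c u) (i≡j⇒i-j≡0 (sym eq)))
    where
    l₁ : ∀ a b c u → (b - u) * a + (c - (+ 1 + b)) + + 1 ≡ a * b + c - (+ 1 * b + u * a)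
    l₁ = solve-∀
  ... | no  u≰b = nonneg+1≢0 (gap< (≰⇒> u≰b) ⊠ 0≤a ⊞ gap< c<a+b) (trans (l₂ a b c u) (i≡j⇒i-j≡0 eq))
    where
    l₂ : ∀ a b c u → (u - (+ 1 + b)) * a + (a + b - (+ 1 + c)) + + 1 ≡ + 1 * b + u * a - (a * b + c)
    l₂ = solve-∀

  -- When k is positive, r + 2 k ≤ r k + 2 because (r - 2) (k - 1) ≥ 0.
  r+2k≤a+1 : ∀ {a r k} → + 2 ≤ + r → + 2 * + r ≤ + 1 + a → + r * + k < a → + r + + 2 * + k ≤ + 1 + a
  r+2k≤a+1 {a} {r} {zero}  2≤r 2r≤a+1 rk<a = ≤-by (gap 2r≤a+1 ⊞ 0≤+ r) (l a (+ r))
    where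
    l : ∀ a r → + 1 + a - (r + + 0) ≡ + 1 + a - + 2 * r + r
    l = solve-∀
  r+2k≤a+1 {a} {r} {suc k} 2≤r 2r≤a+1 rk<a = ≤-by (gap< rk<a ⊞ gap 2≤r ⊠ 0≤+ k) (l a (+ r) (+ k))
    where
    l : ∀ a r k → + 1 + a - (r + + 2 * (+ 1 + k)) ≡ a - (+ 1 + r * (+ 1 + k)) + (r - + 2) * k
    l = solve-∀

  -- Eliminating `k` by `r + 2 k ≤ a + 1` leaves `r` with coefficient `12 (2 b - c)`, nonnegative by
  -- `2 c ≤ 3 b`, so `2 r ≤ a + 1` eliminates `r` as well. The remaining `18 c - 12 a` is at most
  -- `10 c` by `2 c ≤ 3 a`.
  12shifted≤ : ∀ {a b c r k F} → 0ℤ ≤ b → 0ℤ ≤ c →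
    + 2 * c ≤ + 3 * a → + 2 * c ≤ + 3 * b → + 2 * r ≤ + 1 + a → r + + 2 * k ≤ + 1 + a →
    F ≤ (r - + 1) * b + k * c - a →
    + 12 * shifted a b c F ≤ + 12 * a * b + + 6 * a * c + + 10 * c
  12shifted≤ {a} {b} {c} {r} {k} {F} 0≤b 0≤c 2c≤3a 2c≤3b 2r≤a+1 r+2k≤a+1 F≤ = ≤-by
    (0≤+ 4 ⊠ gap 2c≤3a
      ⊞ 0≤+ 12 ⊠ 0≤c ⊠ gap r+2k≤a+1
      ⊞ 0≤+ 3 ⊠ (gap 2c≤3b ⊞ 0≤b) ⊠ gap 2r≤a+1
      ⊞ 0≤+ 24 ⊠ gap F≤)
    (l a b c r k F)
    where
    l : ∀ a b c r k F →
      + 12 * a * b + + 6 * a * c + + 10 * c - + 12 * (+ 2 * F + (a + b + c)) ≡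
        + 4 * (+ 3 * a - + 2 * c)
          + + 12 * c * (+ 1 + a - (r + + 2 * k))
          + + 3 * (+ 3 * b - + 2 * c + b) * (+ 1 + a - + 2 * r)
          + + 24 * ((r - + 1) * b + k * c - a - F)
    l = solve-∀

  last-multiple-< : ∀ a r .{{_ : ℕ.NonZero a}} .{{_ : ℕ.NonZero r}} →
    ∃[ k ] r ℕ.* k ℕ.< a × a ℕ.≤ suc k ℕ.* r
  last-multiple-< (suc a-1) r =
    -- Dividing `a - 1` rather than `a` keeps `r k < a` strict when `r` divides `a`.
    a-1 ℕ./ r ,
    s≤s (subst (ℕ._≤ a-1) (ℕ.*-comm (a-1 ℕ./ r) r) (ℕ.m/n*n≤m a-1 r)) ,
    subst (ℕ._< suc (a-1 ℕ./ r) ℕ.* r) (sym (ℕ.m≡m%n+[m/n]*n a-1 r)) (ℕ.+-monoˡ-< _ (ℕ.m%n<n a-1 r))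

  -- Three entries close to each other, with `2 r ≤ a + 1`.

  module _ {a b c : ℕ} .{{_ : ℕ.NonZero a}} (0<a : + 0 < + a) (0<b : + 0 < + b) (a⊥b : Coprime a b)
    (a<c : + a < + c) (b<c : + b < + c) (c<a+b : + c < + a + + b) (cs<4ab : + c * (+ a + + b + + c) < + 4 * + a * + b)
    where

    private
      module I = Inequalities {+ a} {+ b} {+ c} 0<a 0<b

    cs<4ba : + c * (+ b + + a + + c) < + 4 * + b * + a
    cs<4ba = subst₂ _<_ (cong (λ x → + c * (x + + c)) (+-comm (+ a) (+ b))) (l (+ a) (+ b)) cs<4ab
      where
      l : ∀ a b → + 4 * a * b ≡ + 4 * b * a
      l = solve-∀

    module _ {r k : ℕ} {u F : ℤ} .{{_ : ℕ.NonZero r}} (2≤r : + 2 ≤ + r)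
      (rb+ua≡ab+c : + r * + b + u * + a ≡ + a * + b + + c) (2r≤a+1 : + 2 * + r ≤ + 1 + + a)
      (rk<a : + r * + k < + a) (a≤[1+k]r : a ℕ.≤ suc k ℕ.* r) (F∉ : ¬ F ∈⟨ a , b , c ⟩) where

      private
        g = shifted (+ a) (+ b) (+ c) F
        n = + a * + b * + c * (+ a + + b + + c)

        c≤3b/2 : + 2 * + c ≤ + 3 * + b
        c≤3b/2 = I.2c≤3b (<⇒≤ a<c) cs<4ab

        c≤3a/2 : + 2 * + c ≤ + 3 * + a
        c≤3a/2 = Inequalities.2c≤3b 0<b 0<a (<⇒≤ b<c) cs<4ba

        rb≡ : + r * + b ≡ + c + (+ b - u) * + a
        rb≡ = trans (l₁ (+ r) (+ a) (+ b) u) (trans (cong (_- u * + a) rb+ua≡ab+c) (l₂ (+ a) (+ b) (+ c) u))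
          where
          l₁ : ∀ r a b u → r * b ≡ r * b + u * a - u * a
          l₁ = solve-∀
          l₂ : ∀ a b c u → a * b + c - u * a ≡ c + (b - u) * a
          l₂ = solve-∀

        12g≤ : + 12 * g ≤ + 12 * + a * + b + + 6 * + a * + c + + 10 * + c
        12g≤ = 12shifted≤ {+ a} {+ b} {+ c} {+ r} {+ k} (0≤+ b) (0≤+ c) c≤3a/2 c≤3b/2 2r≤a+1
          (r+2k≤a+1 {+ a} {r} {k} 2≤r 2r≤a+1 rk<a)
          (nonrepresentable-≤ a⊥b {r} {k} {+ b - u} rb≡ a≤[1+k]r F∉)

        l : ∀ g → + 12 * g * (+ 12 * g) ≡ + 144 * (g * g)
        l = solve-∀

      half-bound-2≤r : Bound (+ a) (+ b) (+ c) F
      half-bound-2≤r 0≤g = *-cancelˡ-≤-pos (g * g) n (+ 144)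
        (subst (_≤ + 144 * n) (l g)
          (square-≤ 12g≤
            (I.[12ab+6ac+10c]²≤144abcs a<c b<c c≤3a/2 c≤3b/2 (I.6≤c a<c b<c c≤3a/2 c≤3b/2 cs<4ab))
            (0≤+ 12 ⊠ 0≤g)))

    half-bound : ∀ {r u F} → 0 ℕ.< r → + r * + b + u * + a ≡ + a * + b + + c → + 2 * + r ≤ + 1 + + a →
      ¬ F ∈⟨ a , b , c ⟩ → Bound (+ a) (+ b) (+ c) F
    half-bound {r} {u} 0<r eq 2r≤a+1 F∉ with r ℕ.≟ 1
    ... | yes refl = contradiction eq (b+ua≢ab+c {u = u} (0≤+ a) b<c c<a+b)
    ... | no  r≢1  =
      let instance r≢0 = ℕ.>-nonZero 0<r
          k , rk<a , a≤[1+k]r = last-multiple-< a r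
      in half-bound-2≤r {r} {k} {u} (+≤+ (ℕ.≤∧≢⇒< 0<r (λ 1≡r → r≢1 (sym 1≡r)))) eq 2r≤a+1
        (subst (_< + a) (pos-* r k) (+<+ rk<a)) a≤[1+k]r F∉

  -- Choice of `r` and `u`, and the case distinction.

  coprime-≤⇒< : ∀ {a c} → 1 ℕ.< a → Coprime a c → a ℕ.≤ c → a ℕ.< c
  coprime-≤⇒< 1<a a⊥c a≤c = ℕ.≤∧≢⇒< a≤c λ { refl → ℕ.<⇒≢ 1<a (sym (a⊥c (ℕ.∣-refl , ℕ.∣-refl))) }

  -- Taking the residue `t` of `c - b` instead of `c` puts `r = 1 + t` between `1` and `a`. Then
  -- `r b ≤ a b` leaves `u a ≥ c > 0`, so `u` is positive too.
  residue-pair : ∀ {a b c : ℕ} .{{_ : ℕ.NonZero a}} → Coprime a b → + b < + c →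
    ∃[ r ] ∃[ u ] 0 ℕ.< r × 0 ℕ.< u × + r * + b + + u * + a ≡ + a * + b + + c
  residue-pair {a} {b} {c} a⊥b b<c =
    let t , w , t<a , eq = residue a⊥b (+ c - + b)
    in go t t<a (+ b + w) (trans (l₁ (+ t) (+ a) (+ b) w) (trans (cong (λ x → + b + x + + b * + a) (sym eq)) (l₂ (+ a) (+ b) (+ c))))
    where
    l₁ : ∀ t a b w → (+ 1 + t) * b + (b + w) * a ≡ b + (t * b + w * a) + b * a
    l₁ = solve-∀
    l₂ : ∀ a b c → b + (c - b) + b * a ≡ a * b + c
    l₂ = solve-∀
    l : ∀ t a b c u → (a - (+ 1 + t)) * b + (0ℤ - u) * a + b + (c - (+ 1 + b)) + + 1 ≡ a * b + c - ((+ 1 + t) * b + u * a)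
    l = solve-∀
    u≰0 : ∀ t → t ℕ.< a → ∀ u → (+ 1 + + t) * + b + u * + a ≡ + a * + b + + c → ¬ u ≤ 0ℤ
    u≰0 t t<a u eq u≤0 = nonneg+1≢0 (gap< (+<+ t<a) ⊠ 0≤+ b ⊞ gap u≤0 ⊠ 0≤+ a ⊞ 0≤+ b ⊞ gap< b<c)
      (trans (l (+ t) (+ a) (+ b) (+ c) u) (i≡j⇒i-j≡0 (sym eq)))
    go : ∀ t → t ℕ.< a → ∀ u → (+ 1 + + t) * + b + u * + a ≡ + a * + b + + c →
      ∃[ r ] ∃[ u ] 0 ℕ.< r × 0 ℕ.< u × + r * + b + + u * + a ≡ + a * + b + + c
    go t t<a +0       eq = contradiction ≤-refl (u≰0 t t<a +0 eq)
    go t t<a -[1+ n ] eq = contradiction -≤+ (u≰0 t t<a -[1+ n ] eq)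
    go t t<a (+[1+ n ]) eq = suc t , suc n , s≤s z≤n , s≤s z≤n , eq

  -- If `2 r ≥ a + 2` and `2 u ≥ b + 2`, then `2 (r b + u a) ≥ 2 a b + 2 (a + b) > 2 (a b + c)`.
  complementary-half : ∀ {a b c r u} → 0ℤ ≤ a → 0ℤ ≤ b → c < a + b → r * b + u * a ≡ a * b + c →
    + 1 + a < + 2 * r → + 2 * u ≤ + 1 + b
  complementary-half {a} {b} {c} {r} {u} 0≤a 0≤b c<a+b eq 2r>a+1 = ≤-by-contradiction λ 2u>b+1 → nonneg+1≢0
    (gap< 2r>a+1 ⊠ 0≤b ⊞ 2u>b+1 ⊠ 0≤a ⊞ 0≤+ 2 ⊠ gap< c<a+b ⊞ 0≤+ 1)
    (trans (l r a b c u) (cong (_*_ (+ 2)) (i≡j⇒i-j≡0 eq)))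
    where
    l : ∀ r a b c u → (+ 2 * r - (+ 1 + (+ 1 + a))) * b + (+ 2 * u - (+ 1 + (+ 1 + b))) * a + + 2 * (a + b - (+ 1 + c)) + + 1 + + 1
      ≡ + 2 * (r * b + u * a - (a * b + c))
    l = solve-∀

  module _ {a b c : ℕ} {F : ℤ} .{{_ : ℕ.NonZero a}} .{{_ : ℕ.NonZero b}} (0<a : 0 ℕ.< a) (0<b : 0 ℕ.< b)
    (a<c : + a < + c) (b<c : + b < + c) (a⊥b : Coprime a b) (F∉ : ¬ F ∈⟨ a , b , c ⟩) where

    small-bound : + c < + a + + b → + c * (+ a + + b + + c) < + 4 * + a * + b → Bound (+ a) (+ b) (+ c) F
    small-bound c<a+b cs<4ab =
      let r , u , 0<r , 0<u , eq = residue-pair a⊥b b<c in go r u 0<r 0<u eq (+ 2 * + r ≤? + 1 + + a)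
      where
      go : ∀ r u → 0 ℕ.< r → 0 ℕ.< u → + r * + b + + u * + a ≡ + a * + b + + c → Dec (+ 2 * + r ≤ + 1 + + a) → Bound (+ a) (+ b) (+ c) F
      go r u 0<r 0<u eq (yes 2r≤a+1) = half-bound (+<+ 0<a) (+<+ 0<b) a⊥b a<c b<c c<a+b cs<4ab {r} {+ u} {F} 0<r eq 2r≤a+1 F∉
      -- Now `2 u ≤ b + 1`, and `u a + r b = b a + c` is the same situation with `a`, `r` exchanged
      -- for `b`, `u`.
      go r u 0<r 0<u eq (no 2r≰a+1) = bound-swap (+ a) (+ b) (+ c) F (half-bound (+<+ 0<b) (+<+ 0<a) (Coprime.sym a⊥b) b<c a<c
          (subst (+ c <_) (+-comm (+ a) (+ b)) c<a+b)
          (cs<4ba (+<+ 0<a) (+<+ 0<b) a⊥b a<c b<c c<a+b cs<4ab)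
          {u} {+ r} {F} 0<u
          (trans (+-comm (+ u * + a) (+ r * + b)) (trans eq (cong (_+ + c) (*-comm (+ a) (+ b)))))
          (complementary-half {+ a} {+ b} {+ c} {+ r} {+ u} (0≤+ a) (0≤+ b) c<a+b eq (≰⇒> 2r≰a+1))
          (λ F∈ → F∉ (∈-swap a b c F∈)))

    strict-bound : Bound (+ a) (+ b) (+ c) F
    strict-bound = go (+ a + + b ≤? + c) (+ 4 * + a * + b ≤? + c * (+ a + + b + + c))
      where
      module I = Inequalities {+ a} {+ b} {+ c} (+<+ 0<a) (+<+ 0<b)
      go : Dec (+ a + + b ≤ + c) → Dec (+ 4 * + a * + b ≤ + c * (+ a + + b + + c)) → Bound (+ a) (+ b) (+ c) F
      go (yes a+b≤c) _           = square-≤ (sylvester-≤ a⊥b F∉) (I.sylvester²≤-if-a+b≤c a+b≤c)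
      go (no  a+b≰c) (yes 4ab≤cs) = square-≤ (sylvester-≤ a⊥b F∉) (I.sylvester²≤-if-4ab≤cs (0≤+ c) (<⇒≤ (≰⇒> a+b≰c)) 4ab≤cs)
      go (no  a+b≰c) (no 4ab≰cs) = small-bound (≰⇒> a+b≰c) (≰⇒> 4ab≰cs)

  bound : ∀ {a b c F} → 0 ℕ.< a → a ℕ.≤ b → b ℕ.≤ c →
    Coprime a b → Coprime a c → Coprime b c → ¬ F ∈⟨ a , b , c ⟩ → Bound (+ a) (+ b) (+ c) F
  bound {1} 0<a a≤b b≤c a⊥b a⊥c b⊥c F∉ = bound-1 (ℕ.<-≤-trans 0<a a≤b) (ℕ.<-≤-trans 0<a (ℕ.≤-trans a≤b b≤c)) F∉
  bound {suc (suc _)} {suc (suc _)} {c} 0<a a≤b b≤c a⊥b a⊥c b⊥c F∉ =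
    strict-bound (s≤s z≤n) (s≤s z≤n) (+<+ (coprime-≤⇒< (s≤s (s≤s z≤n)) a⊥c (ℕ.≤-trans a≤b b≤c)))
     (+<+ (coprime-≤⇒< (s≤s (s≤s z≤n)) b⊥c b≤c)) a⊥b F∉
  bound {suc (suc _)} {1} _ (s≤s ())

-- From the squared integer bound to Dedekind cuts.

module Reals where

  open Integers using (_∈⟨_,_,_⟩; shifted; Bound)
  open import Algebra.Properties.Semiring.Sum ℕ.+-*-semiring using (sum; sum-cong-≗; sum-replicate-zero)
  open import Data.Integer.Base as ℤ using (+_; 0ℤ)
  import Data.Integer.Properties as ℤ
  import Data.Integer.Tactic.RingSolver as ℤ-Solver
  open import Data.Rational.Base
  open import Data.Rational.Properties
  import Data.Rational.Unnormalised.Base as ℚᵘ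
  import Data.Rational.Unnormalised.Properties as ℚᵘ
  open import Data.Sum.Base using (inj₁; inj₂)
  open import Data.Vec.Functional using (replicate)

  -- All later generators get coefficient zero, so a number not representable by the whole vector is
  -- not representable by its first three entries.
  represent : ∀ {m} (a : Vector ℕ (3 ℕ.+ m)) {b} → b ∈⟨ a 0F , a 1F , a 2F ⟩ → IsRepresentable a b
  represent {m} a {b} (x , y , z , b≡) = coeff , trans b≡ (sym sum≡)
    where
    coeff : Vector ℕ (3 ℕ.+ m)
    coeff 0F = x
    coeff 1F = y
    coeff 2F = z
    coeff (Fin.suc (Fin.suc (Fin.suc _))) = 0
    tail : Vector ℕ m
    tail i = a (Fin.suc (Fin.suc (Fin.suc i))) ℕ.* 0
    tail≡0 : sum tail ≡ 0
    tail≡0 = trans (sum-cong-≗ {y = replicate m 0} (λ i → ℕ.*-zeroʳ (a (Fin.suc (Fin.suc (Fin.suc i)))))) (sum-replicate-zero m)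
    sum≡ : + (a 0F ℕ.* x ℕ.+ (a 1F ℕ.* y ℕ.+ (a 2F ℕ.* z ℕ.+ sum tail))) ≡ + a 0F ℤ.* + x ℤ.+ + a 1F ℤ.* + y ℤ.+ + a 2F ℤ.* + z
    sum≡ = begin
      + (a 0F ℕ.* x ℕ.+ (a 1F ℕ.* y ℕ.+ (a 2F ℕ.* z ℕ.+ sum tail)))
        ≡⟨ cong (λ t → + (a 0F ℕ.* x ℕ.+ (a 1F ℕ.* y ℕ.+ t))) (trans (cong (a 2F ℕ.* z ℕ.+_) tail≡0) (ℕ.+-identityʳ _)) ⟩
      + (a 0F ℕ.* x ℕ.+ (a 1F ℕ.* y ℕ.+ a 2F ℕ.* z))
        ≡⟨ cong +_ (ℕ.+-assoc (a 0F ℕ.* x) _ _) ⟨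
      + (a 0F ℕ.* x) ℤ.+ + (a 1F ℕ.* y) ℤ.+ + (a 2F ℕ.* z)
        ≡⟨ cong₂ ℤ._+_ (cong₂ ℤ._+_ (ℤ.pos-* (a 0F) x) (ℤ.pos-* (a 1F) y)) (ℤ.pos-* (a 2F) z) ⟩
      + a 0F ℤ.* + x ℤ.+ + a 1F ℤ.* + y ℤ.+ + a 2F ℤ.* + z ∎
      where open ≡-Reasoning

  -- The fraction `i / 1` is normalised by a gcd, so the identity is checked on unnormalised
  -- fractions, where it is integer arithmetic.
  /1-+ : ∀ i j → (i ℤ.+ j) / 1 ≡ i / 1 + j / 1
  /1-+ i j = toℚᵘ-injective (begin
    toℚᵘ ((i ℤ.+ j) / 1)              ≈⟨ toℚᵘ-fromℚᵘ _ ⟩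
    ℚᵘ.mkℚᵘ (i ℤ.+ j) 0               ≈⟨ ℚᵘ.*≡* (l i j) ⟩
    ℚᵘ.mkℚᵘ i 0 ℚᵘ.+ ℚᵘ.mkℚᵘ j 0      ≈⟨ ℚᵘ.+-cong (toℚᵘ-fromℚᵘ (ℚᵘ.mkℚᵘ i 0)) (toℚᵘ-fromℚᵘ (ℚᵘ.mkℚᵘ j 0)) ⟨
    toℚᵘ (i / 1) ℚᵘ.+ toℚᵘ (j / 1)    ≈⟨ toℚᵘ-homo-+ (i / 1) (j / 1) ⟨
    toℚᵘ (i / 1 + j / 1)              ∎)
    where
    open ℚᵘ.≃-Reasoning
    l : ∀ i j → (i ℤ.+ j) ℤ.* + 1 ≡ (i ℤ.* + 1 ℤ.+ j ℤ.* + 1) ℤ.* + 1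
    l = ℤ-Solver.solve-∀

  /1-* : ∀ i j → (i ℤ.* j) / 1 ≡ (i / 1) * (j / 1)
  /1-* i j = toℚᵘ-injective (begin
    toℚᵘ ((i ℤ.* j) / 1)              ≈⟨ toℚᵘ-fromℚᵘ _ ⟩
    ℚᵘ.mkℚᵘ i 0 ℚᵘ.* ℚᵘ.mkℚᵘ j 0      ≈⟨ ℚᵘ.*-cong (toℚᵘ-fromℚᵘ (ℚᵘ.mkℚᵘ i 0)) (toℚᵘ-fromℚᵘ (ℚᵘ.mkℚᵘ j 0)) ⟨
    toℚᵘ (i / 1) ℚᵘ.* toℚᵘ (j / 1)    ≈⟨ toℚᵘ-homo-* (i / 1) (j / 1) ⟨
    toℚᵘ ((i / 1) * (j / 1))          ∎)
    where open ℚᵘ.≃-Reasoning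

  /1-mono-≤ : ∀ {i j} → i ℤ.≤ j → i / 1 ≤ j / 1
  /1-mono-≤ {i} {j} i≤j = toℚᵘ-cancel-≤ (begin
    toℚᵘ (i / 1)    ≃⟨ toℚᵘ-fromℚᵘ _ ⟩
    ℚᵘ.mkℚᵘ i 0     ≤⟨ ℚᵘ.*≤* (ℤ.*-monoʳ-≤-nonNeg (+ 1) i≤j) ⟩
    ℚᵘ.mkℚᵘ j 0     ≃⟨ toℚᵘ-fromℚᵘ _ ⟨
    toℚᵘ (j / 1)    ∎)
    where open ℚᵘ.≤-Reasoning

  square-mono-< : ∀ {p q} → 0ℚ ≤ p → p < q → p * p < q * q
  square-mono-< {p} {q} 0≤p p<q = ≤-<-trans
    (*-monoˡ-≤-nonNeg p {{nonNegative 0≤p}} (<⇒≤ p<q))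
    (*-monoˡ-<-pos q {{positive (≤-<-trans 0≤p p<q)}} p<q)

  -- A negative `y` lies in the lower cut by definition. Otherwise `y < g` forces `g` to be
  -- nonnegative, which releases the squared bound, and `y^2 < g^2 ≤ n`.
  <√ : ∀ {y g n} → y < g / 1 → (0ℤ ℤ.≤ g → g ℤ.* g ℤ.≤ + n) → ℝ.L (√ n) y
  <√ {y} {g} {n} y<g g²≤n with y <? 0ℚ
  ... | yes y<0 = inj₁ y<0
  ... | no  y≮0 = inj₂ (<-≤-trans (square-mono-< (≮⇒≥ y≮0) y<g)
    (subst (_≤ + n / 1) (/1-* g g) (/1-mono-≤ (g²≤n 0≤g))))
    where
    0≤g : 0ℤ ℤ.≤ g
    0≤g with 0ℤ ℤ.≤? g
    ... | yes 0≤g = 0≤g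
    ... | no  0≰g = contradiction (<-≤-trans y<g (/1-mono-≤ (ℤ.<⇒≤ (ℤ.≰⇒> 0≰g)))) y≮0

  frobenius-≤ᵣ : ∀ a b c F → Bound (+ a) (+ b) (+ c) F →
    fromℤ F ≤ᵣ ½· (√ (a ℕ.* b ℕ.* c ℕ.* (a ℕ.+ b ℕ.+ c)) -ᵣ a -ᵣ b -ᵣ c)
  frobenius-≤ᵣ a b c F bound {q} q<F = <√ y<g (λ 0≤g → subst (g ℤ.* g ℤ.≤_) n≡ (bound 0≤g))
    where
    g = shifted (+ a) (+ b) (+ c) F
    n≡ : + a ℤ.* + b ℤ.* + c ℤ.* (+ a ℤ.+ + b ℤ.+ + c) ≡ + (a ℕ.* b ℕ.* c ℕ.* (a ℕ.+ b ℕ.+ c))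
    n≡ = sym (trans (ℤ.pos-* (a ℕ.* b ℕ.* c) (a ℕ.+ b ℕ.+ c)) (cong (ℤ._* (+ a ℤ.+ + b ℤ.+ + c))
      (trans (ℤ.pos-* (a ℕ.* b) c) (cong (ℤ._* + c) (ℤ.pos-* a b)))))
    l : ∀ F a b c → + 2 ℤ.* F ℤ.+ (a ℤ.+ b ℤ.+ c) ≡ F ℤ.+ F ℤ.+ c ℤ.+ b ℤ.+ a
    l = ℤ-Solver.solve-∀
    g/1≡ : g / 1 ≡ F / 1 + F / 1 + + c / 1 + + b / 1 + + a / 1
    g/1≡ = begin
      g / 1 ≡⟨ cong (_/ 1) (l F (+ a) (+ b) (+ c)) ⟩
      (F ℤ.+ F ℤ.+ + c ℤ.+ + b ℤ.+ + a) / 1 ≡⟨ /1-+ (F ℤ.+ F ℤ.+ + c ℤ.+ + b) (+ a) ⟩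
      (F ℤ.+ F ℤ.+ + c ℤ.+ + b) / 1 + + a / 1 ≡⟨ cong (_+ + a / 1) (/1-+ (F ℤ.+ F ℤ.+ + c) (+ b)) ⟩
      (F ℤ.+ F ℤ.+ + c) / 1 + + b / 1 + + a / 1 ≡⟨ cong (λ x → x + + b / 1 + + a / 1) (/1-+ (F ℤ.+ F) (+ c)) ⟩
      (F ℤ.+ F) / 1 + + c / 1 + + b / 1 + + a / 1 ≡⟨ cong (λ x → x + + c / 1 + + b / 1 + + a / 1) (/1-+ F F) ⟩
      F / 1 + F / 1 + + c / 1 + + b / 1 + + a / 1 ∎
      where open ≡-Reasoning
    -- Membership of `q` in the lower cut on the right unfolds to membership of this sum in the cut
    -- of the root: halving doubles `q`, then the subtractions are undone from the outermost, `c`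
    -- first.
    y<g : q + q + + c / 1 + + b / 1 + + a / 1 < g / 1
    y<g = subst (q + q + + c / 1 + + b / 1 + + a / 1 <_) (sym g/1≡)
      (+-monoˡ-< (+ a / 1) (+-monoˡ-< (+ b / 1) (+-monoˡ-< (+ c / 1) (+-mono-< q<F q<F))))

open import Data.Nat.Base using (_+_; _*_; _≤_; _<_)

theorem2 : (m : ℕ) (a : Vector ℕ (3 + m)) →
    (∀ i → 0 < a i) →
    (∀ i j → i Fin.≤ j → a i ≤ a j) →
    (∀ i j → i ≢ j → gcd (a i) (a j) ≡ 1) →
    (F : ℤ) → IsFrobeniusNumber a F →
    fromℤ F ≤ᵣ ½· (√ (a 0F * a 1F * a 2F * (a 0F + a 1F + a 2F)) -ᵣ a 0F -ᵣ a 1F -ᵣ a 2F)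
theorem2 m a 0<a mono coprime F (F∉ , _) = Reals.frobenius-≤ᵣ (a 0F) (a 1F) (a 2F) F
  (Integers.bound (0<a 0F) (mono 0F 1F z≤n) (mono 1F 2F (s≤s z≤n))
    (gcd≡1⇒coprime (coprime 0F 1F λ ()))
    (gcd≡1⇒coprime (coprime 0F 2F λ ()))
    (gcd≡1⇒coprime (coprime 1F 2F λ ()))
    (λ F∈ → F∉ (Reals.represent a F∈)))
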